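{- Let $n$ be a positive integer with $n\equiv 0\pmod 4$. If there exists a skew-symmetric conference matrix of order $n$, then there exists a $3$-$(n,4,n/4)$ design with the property that every set of $5$ vertices contains either exactly $0$ or exactly $2$ hyperedges.
   Context: A skew-symmetric conference matrix of order $n$ is an $n\times n$ matrix $S$ with zero diagonal and all off-diagonal entries in $\{ -1,1\}$ such that $S^{\top}=-S$ and $SS^{\top}=(n-1)I$. A $t$-$(v,k,\lambda)$ design is a $k$-uniform hypergraph on a $v$-element vertex set such that any set of $t$ vertices is contained in exactly $\lambda$ hyperedges. -}

module Defs where

open import Algebra.Properties.Semiring.Sum using (sum)
open import Data.Bool using (if_then_else_)
open import Data.Fin using (Fin; _≟_)
open import Data.Fin.Subset using (Subset; ∣_∣)
open import Data.Fin.Subset.Properties using (_⊆?_)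
open import Data.Integer using (ℤ; +_; -_; _-_; _*_; 0ℤ; 1ℤ; -1ℤ)
open import Data.Integer.Properties using (+-*-semiring)
open import Data.List using (List; filter; length)
open import Data.List.Membership.Propositional using (_∈_)
open import Data.List.Relation.Unary.Unique.Propositional using (Unique)
open import Data.Nat using (ℕ)
open import Data.Sum using (_⊎_)
open import Relation.Binary.PropositionalEquality using (_≡_; _≢_)
open import Relation.Nullary.Decidable using (does)

Matrix : ℕ → Set
Matrix n = Fin n → Fin n → ℤ

_ᵀ : ∀ {n} → Matrix n → Matrix n
(A ᵀ) i j = A j i

_·_ : ∀ {n} → Matrix n → Matrix n → Matrix n
(A · B) i j = sum +-*-semiring (λ k → A i k * B k j)

I : ∀ {n} → Matrix n
I i j = if does (i ≟ j) then 1ℤ else 0ℤ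

record IsSkewConference {n : ℕ} (S : Matrix n) : Set where
  field
    zero-diagonal : ∀ i → S i i ≡ 0ℤ
    off-diagonal  : ∀ i j → i ≢ j → S i j ≡ -1ℤ ⊎ S i j ≡ 1ℤ
    skew          : ∀ i j → (S ᵀ) i j ≡ - S i j
    conference    : ∀ i j → (S · (S ᵀ)) i j ≡ (+ n - 1ℤ) * I i j

-- The set of hyperedges is given by a duplicate-free list, so that lengths of
-- filtered lists of hyperedges are cardinalities.
record Hypergraph (v : ℕ) : Set where
  field
    edges  : List (Subset v)
    unique : Unique edges

open Hypergraph public

Uniform : ∀ {v} → ℕ → Hypergraph v → Set
Uniform k H = ∀ e → e ∈ edges H → ∣ e ∣ ≡ k

#edges⊇ : ∀ {v} → Hypergraph v → Subset v → ℕ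
#edges⊇ H T = length (filter (λ e → T ⊆? e) (edges H))

#edges⊆ : ∀ {v} → Hypergraph v → Subset v → ℕ
#edges⊆ H F = length (filter (λ e → e ⊆? F) (edges H))

record IsDesign (t v k l : ℕ) (H : Hypergraph v) : Set where
  field
    uniform  : Uniform k H
    balanced : ∀ (T : Subset v) → ∣ T ∣ ≡ t → #edges⊇ H T ≡ l

{-# OPTIONS --safe #-}
-- Call {w,x,y,z} an edge when the three terms a = s_wx s_yz, b = - s_wy s_xz and
-- c = s_wz s_xy of the Pfaffian of the principal 4 × 4 submatrix coincide.  For signs
-- a, b, c the number q = 1 + (a b + b c + c a) is 4 if a = b = c and 0 otherwise, and
-- q also vanishes when w ∈ {x,y,z}.  Each of a b, b c, c a is ± 1 times a product of two
-- entries of column w lying in distinct rows, so summing q over all w gives n by row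
-- orthogonality; hence every triple is in n / 4 edges.  On five vertices the five
-- values of q depend on ten signs only, and they always add up to 0 or 8.
module Submission where

open import Defs
open import Algebra.Properties.Semiring.Sum using (sum; sum-cong-≗; ∑-distrib-+; *-distribˡ-sum)
open import Data.Fin using (Fin; zero; suc; _≟_)
open import Data.Fin.Properties using (suc-injective)
open import Data.Fin.Subset using (Subset; ∣_∣; inside; outside; _⊆_)
open import Data.Fin.Subset.Properties using (_⊆?_; drop-∷-⊆; out⊆; s⊆s; ⊆-refl; p⊆q⇒∣p∣≤∣q∣)
open import Data.Integer using (ℤ; +_; -_; _-_; _+_; _*_; 0ℤ; 1ℤ; -1ℤ)
open import Data.Integer.Properties as ℤ using (+-*-semiring)
open import Data.Integer.Tactic.RingSolver using (solve-∀)
open import Data.List using (List; []; _∷_; _++_; map; filter; length; foldr; tabulate; allFin)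
open import Data.List.Membership.Propositional using (_∈_; _∉_)
open import Data.List.Membership.Propositional.Properties
  using (∈-filter⁺; ∈-filter⁻; ∈-map⁺; ∈-map⁻; ∈-++⁺ˡ; ∈-++⁺ʳ; ∈-allFin)
import Data.List.Membership.DecPropositional as DecMembership
open import Data.List.Membership.Propositional.Properties.WithK using (unique∧set⇒bag)
open import Data.List.Properties using (++-assoc; length-map; map-tabulate)
open import Data.List.Relation.Binary.BagAndSetEquality using (∼bag⇒↭)
open import Data.List.Relation.Binary.Disjoint.Propositional using (Disjoint)
open import Data.List.Relation.Binary.Permutation.Propositional
  using (_↭_; refl; prep; swap; ↭-refl; ↭-sym; ↭-trans)
open import Data.List.Relation.Binary.Permutation.Propositional.Properties
  using (↭-length; shift; drop-∷)
import Data.List.Relation.Binary.Permutation.Propositional.Properties as ↭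
open import Data.List.Relation.Unary.All as All using (All; []; _∷_)
import Data.List.Relation.Unary.All.Properties as All
open import Data.List.Relation.Unary.AllPairs using ([]; _∷_)
open import Data.List.Relation.Unary.Any using (here; there)
open import Data.List.Relation.Unary.Unique.Propositional using (Unique)
open import Data.List.Relation.Unary.Unique.Propositional.Properties
  using (map⁺; ++⁺; filter⁺; allFin⁺)
open import Data.Nat as ℕ using (ℕ; zero; suc; _<_; _%_; _/_)
open import Data.Nat.DivMod using (m*n/n≡m)
import Data.Nat.Properties as ℕ
open import Data.Product using (Σ; ∃; _×_; _,_; proj₁; proj₂)
open import Data.Sum as Sum using (_⊎_; inj₁; inj₂)
open import Data.Vec using ([]; _∷_; _[_]≔_; here; there)
open import Data.Vec.Properties using (∷-injectiveʳ)
open import Function using (_∘_)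
open import Function.Bundles using (mk⇔)
open import Relation.Binary.PropositionalEquality
open import Relation.Nullary using (Dec; yes; no; contradiction)
open import Relation.Nullary.Decidable using (map′; _×-dec_; _⊎-dec_; from-yes; dec-no)

-- Lists and subsets

unique∧set⇒length : ∀ {A : Set} {xs ys : List A} → Unique xs → Unique ys →
  (∀ {x} → x ∈ xs → x ∈ ys) → (∀ {x} → x ∈ ys → x ∈ xs) → length xs ≡ length ys
unique∧set⇒length xs! ys! to from =
  ↭-length (∼bag⇒↭ (unique∧set⇒bag xs! ys! (mk⇔ to from)))

-- Injectivity is asked only where `P` holds, because inserting a point is injective only on points
-- outside the set, and deleting one only on points inside it.
map-unique : ∀ {A B : Set} {P : A → Set} {f : A → B} →
  (∀ {x y} → P x → P y → f x ≡ f y → x ≡ y) →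
  ∀ {xs} → All P xs → Unique xs → Unique (map f xs)
map-unique inj []         []           = []
map-unique inj (px ∷ pxs) (x∉xs ∷ xs!) =
  All.map⁺ (All.zipWith (λ (py , x≢y) fx≡fy → x≢y (inj px py fx≡fy)) (pxs , x∉xs))
  ∷ map-unique inj pxs xs!

subsets : ∀ n → List (Subset n)
subsets zero    = [] ∷ []
subsets (suc n) = map (outside ∷_) (subsets n) ++ map (inside ∷_) (subsets n)

∈-subsets : ∀ {n} (p : Subset n) → p ∈ subsets n
∈-subsets []            = here refl
∈-subsets (outside ∷ p) = ∈-++⁺ˡ (∈-map⁺ (outside ∷_) (∈-subsets p))
∈-subsets (inside ∷ p)  = ∈-++⁺ʳ _ (∈-map⁺ (inside ∷_) (∈-subsets p))

subsets-unique : ∀ n → Unique (subsets n)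
subsets-unique zero    = [] ∷ []
subsets-unique (suc n) =
  ++⁺ (map⁺ ∷-injectiveʳ (subsets-unique n)) (map⁺ ∷-injectiveʳ (subsets-unique n)) disjoint
  where
  disjoint : Disjoint (map (outside ∷_) (subsets n)) (map (inside ∷_) (subsets n))
  disjoint (p∈out , p∈in) with ∈-map⁻ (outside ∷_) p∈out | ∈-map⁻ (inside ∷_) p∈in
  ... | _ , _ , refl | _ , _ , ()

elements : ∀ {n} → Subset n → List (Fin n)
elements []            = []
elements (outside ∷ p) = map suc (elements p)
elements (inside ∷ p)  = zero ∷ map suc (elements p)

length-elements : ∀ {n} (p : Subset n) → length (elements p) ≡ ∣ p ∣
length-elements []            = refl
length-elements (outside ∷ p) = trans (length-map suc (elements p)) (length-elements p)
length-elements (inside ∷ p)  = cong suc (trans (length-map suc (elements p)) (length-elements p))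

zero∉map-suc : ∀ {n} (xs : List (Fin n)) → All (_≢_ {A = Fin (suc n)} zero) (map suc xs)
zero∉map-suc xs = All.map⁺ (All.universal (λ _ ()) xs)

elements-unique : ∀ {n} (p : Subset n) → Unique (elements p)
elements-unique []            = []
elements-unique (outside ∷ p) = map⁺ suc-injective (elements-unique p)
elements-unique (inside ∷ p)  = zero∉map-suc (elements p) ∷ map⁺ suc-injective (elements-unique p)

-- The covering relation of the Boolean lattice: the larger set gains exactly the point `x`. As an
-- inductive family it serves insertion and deletion alike, without side conditions on membership.
data Cover : ∀ {n} → Subset n → Fin n → Subset n → Set where
  here  : ∀ {n} {p : Subset n} → Cover (outside ∷ p) zero (inside ∷ p)
  there : ∀ {n s x} {p q : Subset n} → Cover p x q → Cover (s ∷ p) (suc x) (s ∷ q)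

-- The new point sits at its sorted position in `elements q`, so only a permutation can be claimed;
-- that suffices for functions that ignore order.
cover-elements : ∀ {n x} {p q : Subset n} → Cover p x q → elements q ↭ x ∷ elements p
cover-elements here                       = ↭-refl
cover-elements (there {s = outside} c)    = ↭.map⁺ suc (cover-elements c)
cover-elements (there {s = inside} {x} c) =
  ↭-trans (prep zero (↭.map⁺ suc (cover-elements c))) (swap zero (suc x) refl)

cover-⊆ : ∀ {n x} {p q : Subset n} → Cover p x q → p ⊆ q
cover-⊆ here      = out⊆ ⊆-refl
cover-⊆ (there c) = s⊆s (cover-⊆ c)

cover-card : ∀ {n x} {p q : Subset n} → Cover p x q → ∣ q ∣ ≡ suc ∣ p ∣
cover-card {p = p} {q} c = trans (sym (length-elements q))
  (trans (↭-length (cover-elements c)) (cong suc (length-elements p)))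

cover-insert : ∀ {n x} {p q : Subset n} → Cover p x q → q ≡ p [ x ]≔ inside
cover-insert here      = refl
cover-insert (there c) = cong (_ ∷_) (cover-insert c)

cover-delete : ∀ {n x} {p q : Subset n} → Cover p x q → p ≡ q [ x ]≔ outside
cover-delete here      = refl
cover-delete (there c) = cong (_ ∷_) (cover-delete c)

-- Source of both injectivity arguments: with the smaller set fixed it separates insertions, with
-- the larger set fixed it separates deletions.
cover-point : ∀ {n x y} {p q : Subset n} → Cover p x q → Cover p y q → x ≡ y
cover-point here      here      = refl
cover-point (there c) (there d) = cong suc (cover-point c d)

insert-cover : ∀ {n} {x : Fin n} {p} → x ∉ elements p → Cover p x (p [ x ]≔ inside)
insert-cover {x = zero}  {outside ∷ p} _   = here
insert-cover {x = zero}  {inside ∷ p}  x∉p = contradiction (here refl) x∉p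
insert-cover {x = suc x} {outside ∷ p} x∉p = there (insert-cover (x∉p ∘ ∈-map⁺ suc))
insert-cover {x = suc x} {inside ∷ p}  x∉p = there (insert-cover (x∉p ∘ there ∘ ∈-map⁺ suc))

delete-cover : ∀ {n} {x : Fin n} {q} → x ∈ elements q → Cover (q [ x ]≔ outside) x q
delete-cover {q = outside ∷ q} x∈q with ∈-map⁻ suc x∈q
... | _ , y∈q , refl = there (delete-cover y∈q)
delete-cover {q = inside ∷ q} (here refl) = here
delete-cover {q = inside ∷ q} (there x∈q) with ∈-map⁻ suc x∈q
... | _ , y∈q , refl = there (delete-cover y∈q)

⊆∧card≡⇒≡ : ∀ {n} {p q : Subset n} → p ⊆ q → ∣ q ∣ ≡ ∣ p ∣ → q ≡ p
⊆∧card≡⇒≡ {p = []}          {[]}          p⊆q eq = refl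
⊆∧card≡⇒≡ {p = outside ∷ p} {outside ∷ q} p⊆q eq =
  cong (_ ∷_) (⊆∧card≡⇒≡ (drop-∷-⊆ p⊆q) eq)
⊆∧card≡⇒≡ {p = outside ∷ p} {inside ∷ q}  p⊆q eq =
  contradiction (p⊆q⇒∣p∣≤∣q∣ (drop-∷-⊆ p⊆q)) (ℕ.<⇒≱ (ℕ.≤-reflexive eq))
⊆∧card≡⇒≡ {p = inside ∷ p}  {outside ∷ q} p⊆q eq = contradiction (p⊆q here) λ ()
⊆∧card≡⇒≡ {p = inside ∷ p}  {inside ∷ q}  p⊆q eq =
  cong (_ ∷_) (⊆∧card≡⇒≡ (drop-∷-⊆ p⊆q) (ℕ.suc-injective eq))

-- At the first coordinate where the sets differ, the one spare element is used up, so the remaining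
-- tails have equal size and must coincide.
⊆⇒cover : ∀ {n} {p q : Subset n} → p ⊆ q → ∣ q ∣ ≡ suc ∣ p ∣ → ∃ λ x → Cover p x q
⊆⇒cover {p = outside ∷ p} {outside ∷ q} p⊆q eq with ⊆⇒cover (drop-∷-⊆ p⊆q) eq
... | x , c = suc x , there c
⊆⇒cover {p = outside ∷ p} {inside ∷ q}  p⊆q eq
  with refl ← ⊆∧card≡⇒≡ (drop-∷-⊆ p⊆q) (ℕ.suc-injective eq) = zero , here
⊆⇒cover {p = inside ∷ p}  {outside ∷ q} p⊆q eq = contradiction (p⊆q here) λ ()
⊆⇒cover {p = inside ∷ p}  {inside ∷ q}  p⊆q eq
  with ⊆⇒cover (drop-∷-⊆ p⊆q) (ℕ.suc-injective eq)
... | x , c = suc x , there c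

cover-∈ : ∀ {n x} {p q : Subset n} → Cover p x q → x ∈ elements q
cover-∈ c = ↭.∈-resp-↭ (↭-sym (cover-elements c)) (here refl)

-- Signs

Signed : ℤ → Set
Signed x = x ≡ -1ℤ ⊎ x ≡ 1ℤ

-- Reduces a quantifier over signs to two cases, so that nested sign statements are settled by
-- evaluation.
∀signed? : ∀ {P : ℤ → Set} → (∀ x → Dec (P x)) → Dec (∀ x → Signed x → P x)
∀signed? {P} P? = map′ to from (P? -1ℤ ×-dec P? 1ℤ)
  where
  to : P -1ℤ × P 1ℤ → ∀ x → Signed x → P x
  to (p , _) _ (inj₁ refl) = p
  to (_ , p) _ (inj₂ refl) = p
  from : (∀ x → Signed x → P x) → P -1ℤ × P 1ℤ
  from p = p -1ℤ (inj₁ refl) , p 1ℤ (inj₂ refl)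

φ : ℤ → ℤ → ℤ → ℤ
φ a b c = 1ℤ + (a * b + b * c + c * a)

-- The arguments are the upper triangle of a skew 4 × 4 matrix, row by row.
pf : ℤ → ℤ → ℤ → ℤ → ℤ → ℤ → ℤ
pf wx wy wz xy xz yz = φ (wx * yz) (- (wy * xz)) (wz * xy)

pf-signed : ∀ wx → Signed wx → ∀ wy → Signed wy → ∀ wz → Signed wz →
  ∀ xy → Signed xy → ∀ xz → Signed xz → ∀ yz → Signed yz →
  pf wx wy wz xy xz yz ≡ 0ℤ ⊎ pf wx wy wz xy xz yz ≡ + 4
pf-signed = from-yes
  (∀signed? λ wx → ∀signed? λ wy → ∀signed? λ wz → ∀signed? λ xy → ∀signed? λ xz → ∀signed? λ yz →
    (pf wx wy wz xy xz yz ℤ.≟ 0ℤ) ⊎-dec (pf wx wy wz xy xz yz ℤ.≟ + 4))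

-- The three cases are w = x, w = y and w = z, with the entries below the diagonal already written
-- through skewness. Each time one Pfaffian term is 0 and the other two are opposite signs, so the
-- pairwise products sum to -1.
pf-zero : ∀ xy → Signed xy → ∀ xz → Signed xz → ∀ yz → Signed yz →
  pf 0ℤ xy xz xy xz yz ≡ 0ℤ × pf (- xy) 0ℤ yz xy xz yz ≡ 0ℤ × pf (- xz) (- yz) 0ℤ xy xz yz ≡ 0ℤ
pf-zero = from-yes
  (∀signed? λ xy → ∀signed? λ xz → ∀signed? λ yz →
    (pf 0ℤ xy xz xy xz yz ℤ.≟ 0ℤ) ×-dec (pf (- xy) 0ℤ yz xy xz yz ℤ.≟ 0ℤ)
      ×-dec (pf (- xz) (- yz) 0ℤ xy xz yz ℤ.≟ 0ℤ))

-- The summands omit v, w, x, y, z in this order; the final 0 matches the end of the fold in `sumℤ`.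
pf-five : ℤ → ℤ → ℤ → ℤ → ℤ → ℤ → ℤ → ℤ → ℤ → ℤ → ℤ
pf-five vw vx vy vz wx wy wz xy xz yz =
  pf wx wy wz xy xz yz + (pf vx vy vz xy xz yz + (pf vw vy vz wy wz yz
    + (pf vw vx vz wx wz xz + (pf vw vx vy wx wy xy + 0ℤ))))

-- Verified by running through all 1024 sign patterns.
pf-five-signed : ∀ vw → Signed vw → ∀ vx → Signed vx → ∀ vy → Signed vy → ∀ vz → Signed vz →
  ∀ wx → Signed wx → ∀ wy → Signed wy → ∀ wz → Signed wz →
  ∀ xy → Signed xy → ∀ xz → Signed xz → ∀ yz → Signed yz →
  pf-five vw vx vy vz wx wy wz xy xz yz ≡ 0ℤ ⊎ pf-five vw vx vy vz wx wy wz xy xz yz ≡ + 8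
pf-five-signed = from-yes
  (∀signed? λ vw → ∀signed? λ vx → ∀signed? λ vy → ∀signed? λ vz → ∀signed? λ wx →
   ∀signed? λ wy → ∀signed? λ wz → ∀signed? λ xy → ∀signed? λ xz → ∀signed? λ yz →
    (pf-five vw vx vy vz wx wy wz xy xz yz ℤ.≟ 0ℤ)
      ⊎-dec (pf-five vw vx vy vz wx wy wz xy xz yz ℤ.≟ + 8))

-- Counting by summation

sumℤ : List ℤ → ℤ
sumℤ = foldr _+_ 0ℤ

sum≡4*count : ∀ {A : Set} (f : A → ℤ) {xs} → All (λ x → f x ≡ 0ℤ ⊎ f x ≡ + 4) xs →
  sumℤ (map f xs) ≡ + 4 * + length (filter (λ x → f x ℤ.≟ + 4) xs)
sum≡4*count f [] = refl
-- Abstracting `f x` lets the filter on the right compute once the value is known to be 0 or 4.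
sum≡4*count f {x ∷ xs} (fx ∷ fxs) with f x | fx | sum≡4*count f fxs
... | _ | inj₁ refl | ih = trans (ℤ.+-identityˡ _) ih
... | _ | inj₂ refl | ih = trans (cong (_+_ (+ 4)) ih) (distrib (+ length (filter (λ x → f x ℤ.≟ + 4) xs)))
  where
  distrib : ∀ k → + 4 + + 4 * k ≡ + 4 * (1ℤ + k)
  distrib = solve-∀

sum-tabulate : ∀ {n} (f : Fin n → ℤ) → sum +-*-semiring f ≡ sumℤ (tabulate f)
sum-tabulate {zero}  f = refl
sum-tabulate {suc n} f = cong (_+_ (f zero)) (sum-tabulate (f ∘ suc))

sum-one : ∀ n → sum +-*-semiring {n} (λ _ → 1ℤ) ≡ + n
sum-one zero    = refl
sum-one (suc n) = cong (_+_ 1ℤ) (sum-one n)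

-- The Pfaffian indicator of a skew-symmetric conference matrix

module _ {n} {S : Matrix n} (conf : IsSkewConference S) where
  open IsSkewConference conf

  -- The default 0 on lists of other lengths forces every edge to have four points, and lets
  -- permutation invariance be stated for all lists.
  q : List (Fin n) → ℤ
  q (w ∷ x ∷ y ∷ z ∷ []) = pf (S w x) (S w y) (S w z) (S x y) (S x z) (S y z)
  q _                    = 0ℤ

  q≡4⇒length : ∀ xs → q xs ≡ + 4 → length xs ≡ 4
  q≡4⇒length (w ∷ x ∷ y ∷ z ∷ []) _ = refl

  -- The lemmas spell out pf because solve-∀ does not unfold definitions.
  q-swap : ∀ zs x y {xs} → q (zs ++ x ∷ y ∷ xs) ≡ q (zs ++ y ∷ x ∷ xs)
  q-swap []           w x {[]}             = refl
  q-swap []           w x {_ ∷ []}         = refl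
  -- In this and the other two nontrivial cases, an adjacent swap negates all three Pfaffian terms
  -- and permutes them; the sum of their pairwise products is unchanged.
  q-swap []           w x {y ∷ z ∷ []}     rewrite skew w x =
    lemma (S w x) (S w y) (S w z) (S x y) (S x z) (S y z)
    where
    lemma : ∀ wx wy wz xy xz yz →
      1ℤ + ((wx * yz) * - (wy * xz) + - (wy * xz) * (wz * xy) + (wz * xy) * (wx * yz)) ≡
      1ℤ + (((- wx) * yz) * - (xy * wz) + - (xy * wz) * (xz * wy) + (xz * wy) * ((- wx) * yz))
    lemma = solve-∀
  q-swap []           w x {_ ∷ _ ∷ _ ∷ _}  = refl
  q-swap (_ ∷ [])     x y {[]}             = refl
  q-swap (w ∷ [])     x y {z ∷ []}         rewrite skew x y =
    lemma (S w x) (S w y) (S w z) (S x y) (S x z) (S y z)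
    where
    lemma : ∀ wx wy wz xy xz yz →
      1ℤ + ((wx * yz) * - (wy * xz) + - (wy * xz) * (wz * xy) + (wz * xy) * (wx * yz)) ≡
      1ℤ + ((wy * xz) * - (wx * yz) + - (wx * yz) * (wz * (- xy)) + (wz * (- xy)) * (wy * xz))
    lemma = solve-∀
  q-swap (_ ∷ [])     x y {_ ∷ _ ∷ _}      = refl
  q-swap (w ∷ x ∷ []) y z {[]}             rewrite skew y z =
    lemma (S w x) (S w y) (S w z) (S x y) (S x z) (S y z)
    where
    lemma : ∀ wx wy wz xy xz yz →
      1ℤ + ((wx * yz) * - (wy * xz) + - (wy * xz) * (wz * xy) + (wz * xy) * (wx * yz)) ≡
      1ℤ + ((wx * (- yz)) * - (wz * xy) + - (wz * xy) * (wy * xz) + (wy * xz) * (wx * (- yz)))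
    lemma = solve-∀
  q-swap (_ ∷ _ ∷ [])             _ _ {_ ∷ _} = refl
  q-swap (_ ∷ _ ∷ _ ∷ [])         _ _         = refl
  q-swap (_ ∷ _ ∷ _ ∷ _ ∷ [])     _ _         = refl
  q-swap (_ ∷ _ ∷ _ ∷ _ ∷ _ ∷ _)  _ _         = refl

  -- The prefix zs makes the induction go through: q is not compatible with _∷_.
  q-↭-++ : ∀ zs {xs ys} → xs ↭ ys → q (zs ++ xs) ≡ q (zs ++ ys)
  q-↭-++ zs refl                 = refl
  q-↭-++ zs (prep {xs} {ys} x p) =
    subst₂ (λ us vs → q us ≡ q vs) (++-assoc zs (x ∷ []) xs) (++-assoc zs (x ∷ []) ys)
      (q-↭-++ (zs ++ x ∷ []) p)
  q-↭-++ zs (swap {xs} {ys} x y p) = trans (q-swap zs x y)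
    (subst₂ (λ us vs → q us ≡ q vs) (++-assoc zs (y ∷ x ∷ []) xs) (++-assoc zs (y ∷ x ∷ []) ys)
      (q-↭-++ (zs ++ y ∷ x ∷ []) p))
  q-↭-++ zs (_↭_.trans p r)      = trans (q-↭-++ zs p) (q-↭-++ zs r)

  q-↭ : ∀ {xs ys} → xs ↭ ys → q xs ≡ q ys
  q-↭ = q-↭-++ []

  signed : ∀ {x y} → x ≢ y → Signed (S x y)
  signed = off-diagonal _ _

  q-unique : ∀ {xs} → Unique xs → q xs ≡ 0ℤ ⊎ q xs ≡ + 4
  q-unique {[]}                       _ = inj₁ refl
  q-unique {_ ∷ []}                   _ = inj₁ refl
  q-unique {_ ∷ _ ∷ []}               _ = inj₁ refl
  q-unique {_ ∷ _ ∷ _ ∷ []}           _ = inj₁ refl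
  q-unique {w ∷ x ∷ y ∷ z ∷ []}
    ((w≢x ∷ w≢y ∷ w≢z ∷ []) ∷ (x≢y ∷ x≢z ∷ []) ∷ (y≢z ∷ []) ∷ [] ∷ []) =
    pf-signed _ (signed w≢x) _ (signed w≢y) _ (signed w≢z)
              _ (signed x≢y) _ (signed x≢z) _ (signed y≢z)
  q-unique {_ ∷ _ ∷ _ ∷ _ ∷ _ ∷ _}    _ = inj₁ refl

  -- Lets a sum over all columns w count only genuine fourth points.
  q-repeated : ∀ {w x y z} → Unique (x ∷ y ∷ z ∷ []) → w ∈ x ∷ y ∷ z ∷ [] →
    q (w ∷ x ∷ y ∷ z ∷ []) ≡ 0ℤ
  q-repeated {w} {x} {y} {z} ((x≢y ∷ x≢z ∷ []) ∷ (y≢z ∷ []) ∷ [] ∷ []) w∈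
    with zeros ← pf-zero _ (signed x≢y) _ (signed x≢z) _ (signed y≢z) | w∈
  ... | here refl                 rewrite zero-diagonal w = proj₁ zeros
  ... | there (here refl)         rewrite zero-diagonal w | skew x w = proj₁ (proj₂ zeros)
  ... | there (there (here refl)) rewrite zero-diagonal w | skew x w | skew y w = proj₂ (proj₂ zeros)

  q-range : ∀ {x y z} → Unique (x ∷ y ∷ z ∷ []) →
    ∀ w → q (w ∷ x ∷ y ∷ z ∷ []) ≡ 0ℤ ⊎ q (w ∷ x ∷ y ∷ z ∷ []) ≡ + 4
  q-range {x} {y} {z} xyz! w with DecMembership._∈?_ _≟_ w (x ∷ y ∷ z ∷ [])
  ... | yes w∈ = inj₁ (q-repeated xyz! w∈)
  ... | no w∉  = q-unique (All.¬Any⇒All¬ _ w∉ ∷ xyz!)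

  -- An off-diagonal entry of the conference identity.
  orthogonal : ∀ {x y} → x ≢ y → sum +-*-semiring (λ k → S x k * S y k) ≡ 0ℤ
  orthogonal {x} {y} x≢y with conference x y
  ... | eq rewrite dec-no (x ≟ y) x≢y = trans eq (ℤ.*-zeroʳ (+ n - 1ℤ))

  sum-q : ∀ {x y z} → x ≢ y → x ≢ z → y ≢ z →
    sum +-*-semiring (λ w → q (w ∷ x ∷ y ∷ z ∷ [])) ≡ + n
  sum-q {x} {y} {z} x≢y x≢z y≢z = begin
    ∑ (λ w → q (w ∷ x ∷ y ∷ z ∷ []))
      ≡⟨ sum-cong-≗ +-*-semiring expand ⟩
    ∑ (λ w → 1ℤ + (α * (S x w * S y w) + (β * (S y w * S z w) + γ * (S x w * S z w))))
      ≡⟨ ∑-distrib-+ +-*-semiring (λ _ → 1ℤ)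
           (λ w → α * (S x w * S y w) + (β * (S y w * S z w) + γ * (S x w * S z w))) ⟩
    ∑ {n} (λ _ → 1ℤ) + ∑ (λ w → α * (S x w * S y w) + (β * (S y w * S z w) + γ * (S x w * S z w)))
      ≡⟨ cong₂ _+_ (sum-one n) (∑-distrib-+ +-*-semiring (λ w → α * (S x w * S y w))
           (λ w → β * (S y w * S z w) + γ * (S x w * S z w))) ⟩
    + n + (∑ (λ w → α * (S x w * S y w)) + ∑ (λ w → β * (S y w * S z w) + γ * (S x w * S z w)))
      ≡⟨ cong (_+_ (+ n)) (cong₂ _+_ (vanish α x≢y)
           (trans (∑-distrib-+ +-*-semiring (λ w → β * (S y w * S z w)) (λ w → γ * (S x w * S z w)))
             (cong₂ _+_ (vanish β y≢z) (vanish γ x≢z)))) ⟩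
    + n + 0ℤ
      ≡⟨ ℤ.+-identityʳ (+ n) ⟩
    + n ∎
    where
    open ≡-Reasoning
    ∑ : ∀ {m} → (Fin m → ℤ) → ℤ
    ∑ = sum +-*-semiring
    -- The coefficients of the row products in a b, b c and c a. Rewriting column entries `S w x` as
    -- `- S x w` introduces two minus signs per product, which cancel.
    α β γ : ℤ
    α = - (S x z * S y z)
    β = - (S x y * S x z)
    γ = S x y * S y z
    lemma : ∀ xw yw zw xy xz yz → 
      1ℤ + (((- xw) * yz) * - ((- yw) * xz) + - ((- yw) * xz) * ((- zw) * xy) + ((- zw) * xy) * ((- xw) * yz)) ≡
      1ℤ + (- (xz * yz) * (xw * yw) + (- (xy * xz) * (yw * zw) + (xy * yz) * (xw * zw)))
    lemma = solve-∀
    expand : ∀ w → q (w ∷ x ∷ y ∷ z ∷ []) ≡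
      1ℤ + (α * (S x w * S y w) + (β * (S y w * S z w) + γ * (S x w * S z w)))
    expand w rewrite skew x w | skew y w | skew z w =
      lemma (S x w) (S y w) (S z w) (S x y) (S x z) (S y z)
    vanish : ∀ c {u v} → u ≢ v → ∑ (λ w → c * (S u w * S v w)) ≡ 0ℤ
    vanish c {u} {v} u≢v = trans (sym (*-distribˡ-sum +-*-semiring c (λ w → S u w * S v w)))
      (trans (cong (c *_) (orthogonal u≢v)) (ℤ.*-zeroʳ c))

  -- The hypergraph

  edge? : (e : Subset n) → Dec (q (elements e) ≡ + 4)
  edge? e = q (elements e) ℤ.≟ + 4

  -- Testing `q` on the increasing list of members is no restriction, since `q-↭` makes its value
  -- independent of the order.
  H : Hypergraph n
  H = record { edges = filter edge? (subsets n) ; unique = filter⁺ edge? (subsets-unique n) }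

  ∈-edges⁺ : ∀ {e} → q (elements e) ≡ + 4 → e ∈ edges H
  ∈-edges⁺ = ∈-filter⁺ edge? (∈-subsets _)

  ∈-edges⁻ : ∀ {e} → e ∈ edges H → q (elements e) ≡ + 4
  ∈-edges⁻ e∈ = proj₂ (∈-filter⁻ edge? {xs = subsets n} e∈)

  H-uniform : Uniform 4 H
  H-uniform e e∈ = trans (sym (length-elements e)) (q≡4⇒length (elements e) (∈-edges⁻ e∈))

  -- Edges through a triple

  module _ (T : Subset n) where

    extends? : (w : Fin n) → Dec (q (w ∷ elements T) ≡ + 4)
    extends? w = q (w ∷ elements T) ℤ.≟ + 4

    -- An edge through a triple exceeds it by one point, so inserting the extending points
    -- enumerates these edges. Freshness makes each insertion a real cover, hence injective.
    #edges⊇≡ : (∀ {w} → q (w ∷ elements T) ≡ + 4 → w ∉ elements T) → ∣ T ∣ ≡ 3 →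
      #edges⊇ H T ≡ length (filter extends? (allFin n))
    #edges⊇≡ fresh ∣T∣≡3 =
      trans (unique∧set⇒length (filter⁺ (T ⊆?_) (unique H)) inserted! to from)
        (length-map insert (filter extends? (allFin n)))
      where
      insert : Fin n → Subset n
      insert w = T [ w ]≔ inside
      insert-injective : ∀ {v w} → q (v ∷ elements T) ≡ + 4 → q (w ∷ elements T) ≡ + 4 →
        insert v ≡ insert w → v ≡ w
      insert-injective {v} {w} qv qw eq =
        cover-point (insert-cover (fresh qv)) (subst (Cover T w) (sym eq) (insert-cover (fresh qw)))
      inserted! : Unique (map insert (filter extends? (allFin n)))
      inserted! = map-unique insert-injective (All.all-filter extends? (allFin n))
        (filter⁺ extends? (allFin⁺ n))
      to : ∀ {e} → e ∈ filter (T ⊆?_) (edges H) → e ∈ map insert (filter extends? (allFin n))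
      to {e} e∈ with ∈-filter⁻ (T ⊆?_) {xs = edges H} e∈
      ... | e∈H , T⊆e with ⊆⇒cover T⊆e (trans (H-uniform e e∈H) (cong suc (sym ∣T∣≡3)))
      ... | w , c with cover-insert c
      ... | refl = ∈-map⁺ insert (∈-filter⁺ extends? (∈-allFin w)
                     (trans (sym (q-↭ (cover-elements c))) (∈-edges⁻ e∈H)))
      from : ∀ {e} → e ∈ map insert (filter extends? (allFin n)) → e ∈ filter (T ⊆?_) (edges H)
      from e∈ with ∈-map⁻ insert e∈
      ... | w , w∈ , refl with ∈-filter⁻ extends? {xs = allFin n} w∈
      ... | _ , qw with insert-cover (fresh qw)
      ... | c = ∈-filter⁺ (T ⊆?_) (∈-edges⁺ (trans (q-↭ (cover-elements c)) qw)) (cover-⊆ c)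

  H-balanced : ∀ (T : Subset n) → ∣ T ∣ ≡ 3 → #edges⊇ H T ≡ n / 4
  H-balanced T ∣T∣≡3 = go (elements T) refl (elements-unique T) (trans (length-elements T) ∣T∣≡3)
    where
    open ≡-Reasoning
    -- Generalising the list along an equation allows it to be matched as three points while `T`
    -- stays fixed.
    go : ∀ xs → elements T ≡ xs → Unique xs → length xs ≡ 3 → #edges⊇ H T ≡ n / 4
    go (x ∷ y ∷ z ∷ []) eq xyz!@((x≢y ∷ x≢z ∷ []) ∷ (y≢z ∷ []) ∷ [] ∷ []) _ = begin
      #edges⊇ H T     ≡⟨ #edges⊇≡ T fresh ∣T∣≡3 ⟩
      k               ≡⟨ m*n/n≡m k 4 ⟨
      k ℕ.* 4 / 4     ≡⟨ cong (_/ 4) (trans (ℕ.*-comm k 4) (ℤ.+-injective (trans (ℤ.pos-* 4 k) 4k≡n))) ⟩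
      n / 4           ∎
      where
      k : ℕ
      k = length (filter (extends? T) (allFin n))
      f : Fin n → ℤ
      f w = q (w ∷ elements T)
      fresh : ∀ {w} → q (w ∷ elements T) ≡ + 4 → w ∉ elements T
      fresh {w} qw w∈ rewrite eq = contradiction (trans (sym qw) (q-repeated xyz! w∈)) λ ()
      range : ∀ w → f w ≡ 0ℤ ⊎ f w ≡ + 4
      range rewrite eq = q-range xyz!
      total : sum +-*-semiring f ≡ + n
      total rewrite eq = sum-q x≢y x≢z y≢z
      -- Double evaluation of the column sum: each extending point contributes 4 and all others 0,
      -- while orthogonality gives n.
      4k≡n : + 4 * + k ≡ + n
      4k≡n = begin
        + 4 * + k                ≡⟨ sum≡4*count f (All.universal range (allFin n)) ⟨
        sumℤ (map f (allFin n))  ≡⟨ cong sumℤ (map-tabulate (λ i → i) f) ⟩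
        sumℤ (tabulate f)        ≡⟨ sum-tabulate f ⟨
        sum +-*-semiring f       ≡⟨ total ⟩
        + n                      ∎

  -- Edges inside five points

  module _ (F : Subset n) where

    delete : Fin n → Subset n
    delete v = F [ v ]≔ outside

    -- A 4-subset of a 5-set misses exactly one point, so the candidates are the five deletions.
    #edges⊆≡ : ∣ F ∣ ≡ 5 → #edges⊆ H F ≡ length (filter edge? (map delete (elements F)))
    #edges⊆≡ ∣F∣≡5 =
      unique∧set⇒length (filter⁺ (_⊆? F) (unique H)) (filter⁺ edge? deleted!) to from
      where
      delete-injective : ∀ {v w} → v ∈ elements F → w ∈ elements F → delete v ≡ delete w → v ≡ w
      delete-injective {v} {w} v∈ w∈ eq =
        cover-point (delete-cover v∈) (subst (λ p → Cover p w F) (sym eq) (delete-cover w∈))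
      deleted! : Unique (map delete (elements F))
      deleted! = map-unique delete-injective (All.tabulate (λ v∈ → v∈)) (elements-unique F)
      to : ∀ {e} → e ∈ filter (_⊆? F) (edges H) → e ∈ filter edge? (map delete (elements F))
      to {e} e∈ with ∈-filter⁻ (_⊆? F) {xs = edges H} e∈
      ... | e∈H , e⊆F with ⊆⇒cover e⊆F (trans ∣F∣≡5 (cong suc (sym (H-uniform e e∈H))))
      ... | v , c with cover-delete c
      ... | refl = ∈-filter⁺ edge? (∈-map⁺ delete (cover-∈ c)) (∈-edges⁻ e∈H)
      from : ∀ {e} → e ∈ filter edge? (map delete (elements F)) → e ∈ filter (_⊆? F) (edges H)
      from e∈ with ∈-filter⁻ edge? {xs = map delete (elements F)} e∈
      ... | e∈′ , qe with ∈-map⁻ delete e∈′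
      ... | v , v∈ , refl = ∈-filter⁺ (_⊆? F) (∈-edges⁺ qe) (cover-⊆ (delete-cover v∈))

    -- Both `elements (delete v)` and `us ++ ws` become permutations of `elements F` once v is put
    -- in front; cancelling v relates them. All five values of `q` are thereby expressed in one
    -- common ordering of the points.
    q-delete : ∀ us v ws → elements F ≡ us ++ v ∷ ws → q (elements (delete v)) ≡ q (us ++ ws)
    q-delete us v ws eq = q-↭ (drop-∷ (↭-trans (↭-sym (cover-elements (delete-cover {q = F} v∈)))
      (subst (_↭ v ∷ us ++ ws) (sym eq) (shift v us ws))))
      where
      v∈ : v ∈ elements F
      v∈ = subst (v ∈_) (sym eq) (∈-++⁺ʳ us (here refl))

  H-five : ∀ (F : Subset n) → ∣ F ∣ ≡ 5 → #edges⊆ H F ≡ 0 ⊎ #edges⊆ H F ≡ 2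
  H-five F ∣F∣≡5 = subst (λ k → k ≡ 0 ⊎ k ≡ 2) (sym (#edges⊆≡ F ∣F∣≡5))
    (go (elements F) refl (elements-unique F) (trans (length-elements F) ∣F∣≡5))
    where
    d : Fin n → Subset n
    d = delete F
    f : Subset n → ℤ
    f = q ∘ elements
    total : ∀ {v w x y z} → elements F ≡ v ∷ w ∷ x ∷ y ∷ z ∷ [] →
      sumℤ (map f (map d (v ∷ w ∷ x ∷ y ∷ z ∷ []))) ≡
      pf-five (S v w) (S v x) (S v y) (S v z) (S w x) (S w y) (S w z) (S x y) (S x z) (S y z)
    total {v} {w} {x} {y} {z} eq =
      cong₂ _+_ (q-delete F [] v (w ∷ x ∷ y ∷ z ∷ []) eq)
      (cong₂ _+_ (q-delete F (v ∷ []) w (x ∷ y ∷ z ∷ []) eq)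
      (cong₂ _+_ (q-delete F (v ∷ w ∷ []) x (y ∷ z ∷ []) eq)
      (cong₂ _+_ (q-delete F (v ∷ w ∷ x ∷ []) y (z ∷ []) eq)
      (cong₂ _+_ (q-delete F (v ∷ w ∷ x ∷ y ∷ []) z [] eq) refl))))
    -- Turns the totals 0 = 4 · 0 and 8 = 4 · 2 into the counts 0 and 2.
    4k≡⇒k≡ : ∀ {k m} → + 4 * + k ≡ + (4 ℕ.* m) → k ≡ m
    4k≡⇒k≡ {k} {m} eq = ℕ.*-cancelˡ-≡ k m 4 (ℤ.+-injective (trans (ℤ.pos-* 4 k) eq))
    go : ∀ xs → elements F ≡ xs → Unique xs → length xs ≡ 5 →
      length (filter edge? (map d (elements F))) ≡ 0 ⊎ length (filter edge? (map d (elements F))) ≡ 2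
    go (v ∷ w ∷ x ∷ y ∷ z ∷ []) eq
      ((v≢w ∷ v≢x ∷ v≢y ∷ v≢z ∷ []) ∷ (w≢x ∷ w≢y ∷ w≢z ∷ []) ∷ (x≢y ∷ x≢z ∷ []) ∷ (y≢z ∷ []) ∷ [] ∷ []) _
      = Sum.map (4k≡⇒k≡ ∘ trans 4k≡) (4k≡⇒k≡ ∘ trans 4k≡)
          (pf-five-signed _ (signed v≢w) _ (signed v≢x) _ (signed v≢y) _ (signed v≢z)
            _ (signed w≢x) _ (signed w≢y) _ (signed w≢z)
            _ (signed x≢y) _ (signed x≢z) _ (signed y≢z))
      where
      4k≡ : + 4 * + length (filter edge? (map d (elements F))) ≡
        pf-five (S v w) (S v x) (S v y) (S v z) (S w x) (S w y) (S w z) (S x y) (S x z) (S y z)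
      -- Every deletion has a duplicate-free list of members, so `q-unique` supplies the values 0 or
      -- 4 that the count requires.
      4k≡ = trans
        (sym (sum≡4*count f (All.universal (λ e → q-unique (elements-unique e)) (map d (elements F)))))
        (trans (cong (λ us → sumℤ (map f (map d us))) eq) (total eq))

mainTheorem2 : ∀ (n : ℕ) → 0 < n → n % 4 ≡ 0 →
    Σ (Matrix n) (λ S → IsSkewConference S) →
    Σ (Hypergraph n) (λ H →
    IsDesign 3 n 4 (n / 4) H ×
    (∀ (F : Subset n) → ∣ F ∣ ≡ 5 → #edges⊆ H F ≡ 0 ⊎ #edges⊆ H F ≡ 2))
mainTheorem2 n _ _ (S , conf) =
  H conf , record { uniform = H-uniform conf ; balanced = H-balanced conf } , H-five conf
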